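{- For every fixed edge-ordered graph $G$ with at least one edge, $ssat_m(n,G)=O(n\log n)$.
   Context: An edge-ordered graph is a finite simple graph together with a linear order on its edge set (usually given by an injective labeling $l:E\to\mathbb{N}$ or $l:E\to\mathbb{R}$). A copy of $G$ in an edge-ordered graph $H$ is a subgraph of $H$ (with the induced edge-order) isomorphic to $G$ by an isomorphism respecting the edge-order. $ssat_m(n,G)$ is the minimum number of edges in an edge-ordered graph $H$ on $n$ vertices (not required to be $G$-free) such that adding to $H$ any missing edge, inserted at the beginning of the linear order (i.e. with a label smaller than all labels of $H$), creates a new copy of $G$ (one using the added edge). Asymptotic notation is for $n\to\infty$ with $G$ fixed; the implied constant may depend on $G$. -}

module Defs where

open import Data.Empty using (⊥-elim)
open import Data.Fin using (Fin; zero; suc; _<_)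
open import Data.Fin.Properties as Fin using (_≟_; _<?_; any?; all?)
open import Data.List using (List; []; _∷_; length; lookup; filter; cartesianProduct; allFin)
open import Data.List.Membership.Propositional using () renaming (_∈_ to _∈ₗ_)
open import Data.List.Membership.Propositional.Properties
  using (∈-cartesianProduct⁺; ∈-filter⁺; ∈-allFin)
open import Data.List.Relation.Unary.All as All using (All; []; _∷_)
open import Data.List.Relation.Unary.All.Properties using (¬Any⇒All¬; all-filter)
open import Data.List.Relation.Unary.AllPairs as AllPairs using (AllPairs; []; _∷_)
open import Data.List.Relation.Unary.Any as Any using (Any)
open import Data.List.Relation.Unary.Unique.Propositional using (Unique)
import Data.List.Relation.Unary.Unique.Propositional.Properties as Unique
open import Data.Nat as ℕ using (ℕ; zero; suc; _≤_; _≥_; _*_; z≤n; s≤s)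
import Data.Nat.Properties as ℕ
open import Data.Product using (∃; ∃₂; _×_; _,_; proj₁; proj₂; swap; map)
open import Data.Product.Properties using (≡-dec)
open import Data.Sum using (_⊎_; inj₁; inj₂)
open import Data.Vec as Vec using (Vec; []; _∷_; toList; fromList)
open import Data.Vec.Properties using (lookup∘tabulate; length-toList; toList∘fromList)
open import Function using (_∘_)
open import Function.Definitions using (Injective)
open import Relation.Binary using (tri<; tri≈; tri>)
open import Relation.Binary.PropositionalEquality
  using (_≡_; _≢_; _≗_; refl; sym; trans; cong; cong₂; subst; subst₂)
open import Relation.Nullary using (¬_; Dec; yes; no)
open import Relation.Nullary.Decidable using (map′; _×-dec_; _⊎-dec_; _→-dec_; ¬?)

-- Edges are unordered: a pair of vertices is only ever compared up to _≈_.

Pair : ℕ → Set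
Pair n = Fin n × Fin n

infix 4 _≈_ _≉_

_≈_ _≉_ : ∀ {n} → Pair n → Pair n → Set
e ≈ e′ = e ≡ e′ ⊎ e ≡ swap e′
e ≉ e′ = ¬ (e ≈ e′)

Loopless : ∀ {n} → Pair n → Set
Loopless (u , v) = u ≢ v

-- A simple graph on the vertex set Fin n together with a linear order on its
-- edges: the edges are listed once each, from the smallest to the largest.

record EdgeOrderedGraph (n : ℕ) : Set where
  constructor mkGraph
  field
    edges    : List (Pair n)
    loopless : All Loopless edges
    distinct : AllPairs _≉_ edges

open EdgeOrderedGraph public

edgeCount : ∀ {n} → EdgeOrderedGraph n → ℕ
edgeCount H = length (edges H)

infix 4 _∈_ _∉_ _⊢_≺_

_∈_ _∉_ : ∀ {n} → Pair n → EdgeOrderedGraph n → Set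
e ∈ H = Any (e ≈_) (edges H)
e ∉ H = ¬ (e ∈ H)

_⊢_≺_ : ∀ {n} → EdgeOrderedGraph n → Pair n → Pair n → Set
H ⊢ e ≺ e′ = ∃₂ λ i j → i < j × lookup (edges H) i ≈ e × lookup (edges H) j ≈ e′

image : ∀ {m n} → (Fin m → Fin n) → Pair m → Pair n
image φ = map φ φ

-- φ is an isomorphism, respecting the edge orders, from G onto the subgraph
-- of H whose vertices and edges are the images of those of G.

record IsCopy {m n} (G : EdgeOrderedGraph m) (H : EdgeOrderedGraph n)
              (φ : Fin m → Fin n) : Set where
  constructor mkCopy
  field
    injective       : Injective _≡_ _≡_ φ
    preserves-edges : ∀ e → e ∈ G → image φ e ∈ H
    preserves-order : ∀ e e′ → G ⊢ e ≺ e′ → H ⊢ image φ e ≺ image φ e′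

CopyUsing : ∀ {m n} → EdgeOrderedGraph m → EdgeOrderedGraph n → Pair n → Set
CopyUsing G H e = ∃ λ φ → IsCopy G H φ × ∃ λ e′ → e′ ∈ G × image φ e′ ≈ e

Missing : ∀ {n} → EdgeOrderedGraph n → Pair n → Set
Missing H e = Loopless e × e ∉ H

-- The edge list increases, so consing e makes it the smallest edge.

addSmallest : ∀ {n} (H : EdgeOrderedGraph n) (e : Pair n) → Missing H e → EdgeOrderedGraph n
addSmallest H e (e-loopless , e∉H) = mkGraph
  (e ∷ edges H)
  (e-loopless ∷ loopless H)
  (¬Any⇒All¬ (edges H) e∉H ∷ distinct H)

Semisaturated : ∀ {m n} → EdgeOrderedGraph m → EdgeOrderedGraph n → Set
Semisaturated G H = ∀ e (missing : Missing H e) → CopyUsing G (addSmallest H e missing) e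

Attained : ∀ {m} → ℕ → EdgeOrderedGraph m → ℕ → Set
Attained n G k = ∃ λ (H : EdgeOrderedGraph n) → edgeCount H ≡ k × Semisaturated G H

IsMinimum : (ℕ → Set) → ℕ → Set
IsMinimum P k = P k × (∀ j → P j → k ≤ j)

-- Constructively, the existence of the minimum needs Attained to be
-- decidable; some value is attained because a complete graph has no missing edge.

private
  _≈?_ : ∀ {n} (e e′ : Pair n) → Dec (e ≈ e′)
  e ≈? e′ = ≡-dec _≟_ _≟_ e e′ ⊎-dec ≡-dec _≟_ _≟_ e (swap e′)

  _∈?_ : ∀ {n} (e : Pair n) (H : EdgeOrderedGraph n) → Dec (e ∈ H)
  e ∈? H = Any.any? (e ≈?_) (edges H)

  loopless? : ∀ {n} (e : Pair n) → Dec (Loopless e)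
  loopless? (u , v) = ¬? (u ≟ v)

  anyPair? : ∀ {n} {P : Pair n → Set} → (∀ e → Dec (P e)) → Dec (∃ P)
  anyPair? P? = map′ (λ (u , v , p) → (u , v) , p) (λ ((u , v) , p) → u , v , p)
    (any? λ u → any? λ v → P? (u , v))

  allPair? : ∀ {n} {P : Pair n → Set} → (∀ e → Dec (P e)) → Dec (∀ e → P e)
  allPair? P? = map′ (λ f (u , v) → f u v) (λ f u v → f (u , v))
    (all? λ u → all? λ v → P? (u , v))

  anyVec? : {A : Set} → (∀ {P : A → Set} → (∀ x → Dec (P x)) → Dec (∃ P)) →
            ∀ k {P : Vec A k → Set} → (∀ xs → Dec (P xs)) → Dec (∃ P)
  anyVec? any zero    P? = map′ (λ p → [] , p) (λ { ([] , p) → p }) (P? [])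
  anyVec? any (suc k) P? =
    map′ (λ (x , xs , p) → x ∷ xs , p) (λ { (x ∷ xs , p) → x , xs , p })
      (any λ x → anyVec? any k λ xs → P? (x ∷ xs))

  anyFun? : ∀ {m n} {P : (Fin m → Fin n) → Set} → (∀ {φ ψ} → φ ≗ ψ → P φ → P ψ) →
            (∀ φ → Dec (P φ)) → Dec (∃ P)
  anyFun? {m} resp P? =
    map′ (λ (xs , p) → Vec.lookup xs , p)
         (λ (φ , p) → Vec.tabulate φ , resp (λ i → sym (lookup∘tabulate φ i)) p)
      (anyVec? any? m λ xs → P? (Vec.lookup xs))

  precedes? : ∀ {n} (H : EdgeOrderedGraph n) e e′ → Dec (H ⊢ e ≺ e′)
  precedes? H e e′ = any? λ i → any? λ j →
    (i <? j) ×-dec (lookup (edges H) i ≈? e) ×-dec (lookup (edges H) j ≈? e′)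

  module _ {m n : ℕ} (G : EdgeOrderedGraph m) (H : EdgeOrderedGraph n) where

    isCopy? : ∀ φ → Dec (IsCopy G H φ)
    isCopy? φ =
      map′ (λ (i , p , q) → mkCopy (λ {x} {y} → i x y) p q)
           (λ (mkCopy i p q) → (λ x y → i {x} {y}) , p , q)
        ((all? λ x → all? λ y → (φ x ≟ φ y) →-dec (x ≟ y))
          ×-dec (allPair? λ e → (e ∈? G) →-dec (image φ e ∈? H))
          ×-dec (allPair? λ e → allPair? λ e′ →
                  precedes? G e e′ →-dec precedes? H (image φ e) (image φ e′)))

    image-cong : ∀ {φ ψ : Fin m → Fin n} → φ ≗ ψ → image φ ≗ image ψ
    image-cong eq (u , v) = cong₂ _,_ (eq u) (eq v)

    isCopy-resp : ∀ {φ ψ} → φ ≗ ψ → IsCopy G H φ → IsCopy G H ψ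
    isCopy-resp eq (mkCopy i p q) = mkCopy
      (λ {x} {y} ψx≡ψy → i (trans (eq x) (trans ψx≡ψy (sym (eq y)))))
      (λ e e∈G → subst (_∈ H) (image-cong eq e) (p e e∈G))
      (λ e e′ e≺e′ → subst₂ (H ⊢_≺_) (image-cong eq e) (image-cong eq e′) (q e e′ e≺e′))

    copyUsing? : ∀ e → Dec (CopyUsing G H e)
    copyUsing? e = anyFun?
      (λ eq (c , e′ , e′∈G , r) →
        isCopy-resp eq c , e′ , e′∈G , subst (_≈ e) (image-cong eq e′) r)
      (λ φ → isCopy? φ ×-dec anyPair? λ e′ → (e′ ∈? G) ×-dec (image φ e′ ≈? e))

  copyUsing-resp : ∀ {m n} {G : EdgeOrderedGraph m} {H H′ : EdgeOrderedGraph n} {e} →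
                   edges H ≡ edges H′ → CopyUsing G H e → CopyUsing G H′ e
  copyUsing-resp {H = mkGraph _ _ _} {mkGraph _ _ _} refl (φ , mkCopy i p q , r) =
    φ , mkCopy i p q , r

  module _ {m n : ℕ} (G : EdgeOrderedGraph m) where

    semisaturated-resp : {H H′ : EdgeOrderedGraph n} → edges H ≡ edges H′ →
                         Semisaturated G H → Semisaturated G H′
    semisaturated-resp {mkGraph _ _ _} {mkGraph _ _ _} refl s e missing =
      copyUsing-resp refl (s e missing)

    semisaturated? : (H : EdgeOrderedGraph n) → Dec (Semisaturated G H)
    semisaturated? H = allPair? completes?
      where
      completes? : ∀ e → Dec ((missing : Missing H e) → CopyUsing G (addSmallest H e missing) e)
      completes? e with loopless? e ×-dec ¬? (e ∈? H)
      ... | no ¬missing = yes λ missing → ⊥-elim (¬missing missing)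
      ... | yes missing = map′ (λ c _ → copyUsing-resp refl c) (λ f → f missing)
                            (copyUsing? G (addSmallest H e missing) e)

    HasEdges : List (Pair n) → Set
    HasEdges es = ∃ λ (H : EdgeOrderedGraph n) → edges H ≡ es × Semisaturated G H

    hasEdges? : ∀ es → Dec (HasEdges es)
    hasEdges? es with All.all? loopless? es
    ... | no ¬l = no λ { (H , refl , _) → ¬l (loopless H) }
    ... | yes l with AllPairs.allPairs? (λ e e′ → ¬? (e ≈? e′)) es
    ...   | no ¬d = no λ { (H , refl , _) → ¬d (distinct H) }
    ...   | yes d = map′ (λ s → mkGraph es l d , refl , s)
                         (λ (_ , eq , s) → semisaturated-resp eq s)
                      (semisaturated? (mkGraph es l d))

    attained? : ∀ k → Dec (Attained n G k)
    attained? k =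
      map′ (λ (es , H , eq , s) → H , trans (cong length eq) (length-toList es) , s)
           (λ { (H , refl , s) → fromList (edges H) , H , sym (toList∘fromList (edges H)) , s })
        (anyVec? anyPair? k (hasEdges? ∘ toList))

  minimum : ∀ {P : ℕ → Set} → (∀ k → Dec (P k)) → ∀ k → P k → ∃ (IsMinimum P)
  minimum P? k p with P? 0
  minimum P? k       p | yes p₀ = 0 , p₀ , λ _ _ → z≤n
  minimum P? zero    p | no ¬p₀ = ⊥-elim (¬p₀ p)
  minimum P? (suc k) p | no ¬p₀ with minimum (P? ∘ suc) k p
  ... | j , pⱼ , least = suc j , pⱼ , λ { zero p₀ → ⊥-elim (¬p₀ p₀) ; (suc i) pᵢ → s≤s (least i pᵢ) }

  Increasing : ∀ {n} → Pair n → Set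
  Increasing (u , v) = u < v

  increasing? : ∀ {n} (e : Pair n) → Dec (Increasing e)
  increasing? (u , v) = u <? v

  completeEdges : ∀ n → List (Pair n)
  completeEdges n = filter increasing? (cartesianProduct (allFin n) (allFin n))

  completeEdges-increasing : ∀ n → All Increasing (completeEdges n)
  completeEdges-increasing n = all-filter increasing? (cartesianProduct (allFin n) (allFin n))

  distinct-increasing : ∀ {n} {es : List (Pair n)} → All Increasing es → Unique es → AllPairs _≉_ es
  distinct-increasing []       []       = []
  distinct-increasing (p ∷ ps) (d ∷ ds) =
    All.zipWith (λ { (q , e≢e′) (inj₁ e≡e′) → e≢e′ e≡e′
                   ; (q , e≢e′) (inj₂ refl) → Fin.<-asym p q }) (ps , d)
      ∷ distinct-increasing ps ds

  complete : ∀ n → EdgeOrderedGraph n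
  complete n = mkGraph (completeEdges n)
    (All.map (λ u<v u≡v → Fin.<-irrefl u≡v u<v) (completeEdges-increasing n))
    (distinct-increasing (completeEdges-increasing n)
      (Unique.filter⁺ increasing? (Unique.cartesianProduct⁺ (Unique.allFin⁺ n) (Unique.allFin⁺ n))))

  increasing-∈ : ∀ {n} {u v : Fin n} → u < v → (u , v) ∈ₗ completeEdges n
  increasing-∈ {u = u} {v} u<v =
    ∈-filter⁺ increasing? (∈-cartesianProduct⁺ (∈-allFin u) (∈-allFin v)) u<v

  complete-∈ : ∀ {n} (e : Pair n) → Loopless e → e ∈ complete n
  complete-∈ (u , v) u≢v with Fin.<-cmp u v
  ... | tri< u<v _ _ = Any.map inj₁ (increasing-∈ u<v)
  ... | tri≈ _ u≡v _ = ⊥-elim (u≢v u≡v)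
  ... | tri> _ _ v<u = Any.map (λ eq → inj₂ (cong swap eq)) (increasing-∈ v<u)

  complete-semisaturated : ∀ {m} n (G : EdgeOrderedGraph m) → Semisaturated G (complete n)
  complete-semisaturated n G e (l , e∉) = ⊥-elim (e∉ (complete-∈ e l))

minimum-attained : ∀ {m} n (G : EdgeOrderedGraph m) → ∃ (IsMinimum (Attained n G))
minimum-attained n G =
  minimum (attained? G) (edgeCount (complete n)) (complete n , refl , complete-semisaturated n G)

ssatₘ : ∀ {m} → ℕ → EdgeOrderedGraph m → ℕ
ssatₘ n G = proj₁ (minimum-attained n G)

ssatₘ-isMinimum : ∀ {m} n (G : EdgeOrderedGraph m) → IsMinimum (Attained n G) (ssatₘ n G)
ssatₘ-isMinimum n G = proj₂ (minimum-attained n G)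

infix 4 _=O_

_=O_ : (ℕ → ℕ) → (ℕ → ℕ) → Set
f =O g = ∃₂ λ C N → ∀ n → n ≥ N → f n ≤ C * g n

{-# OPTIONS --safe #-}

-- Write x and y for two vertices that differ in the i-th binary digit. For each
-- of the O(log n) digits take one gadget: a copy of G without its smallest edge
-- uv, in which u is blown up to all vertices with i-th digit 0 and v to all
-- vertices with i-th digit 1. Together with uv played by the new edge xy, the
-- i-th gadget completes a copy of G. The vertices of the gadgets other than the
-- blown-up ones are the O(log n) hubs; joining every hub to every vertex costs
-- O(n log n) edges, makes every missing edge avoid the hubs, and leaves the edge
-- order free to be chosen as a sorting by the edge of G that is being imitated.

module Submission where

open import Defs
open import Data.Fin as Fin
  using (Fin; zero; suc; toℕ; fromℕ<; inject≤; combine; remQuot; finToFun; funToFin)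
import Data.Fin.Properties as Fin
open import Data.List using (List; []; _∷_; _++_; map; length; lookup; filter; cartesianProduct; allFin)
import Data.List.Properties as List
open import Data.List.Membership.Propositional using () renaming (_∈_ to _∈ₗ_)
open import Data.List.Membership.Propositional.Properties
  using (∈-map⁺; ∈-cartesianProduct⁺; ∈-filter⁺; ∈-allFin; ∈-lookup)
open import Data.List.Relation.Binary.Permutation.Propositional using (↭-sym; ↭⇒↭ₛ)
open import Data.List.Relation.Binary.Permutation.Propositional.Properties
  using (↭-length; ∈-resp-↭; All-resp-↭)
import Data.List.Relation.Binary.Permutation.Setoid.Properties as Permutation
open import Data.List.Relation.Unary.All as All using (All; []; _∷_)
open import Data.List.Relation.Unary.All.Properties using (all-filter)
open import Data.List.Relation.Unary.AllPairs using (AllPairs; []; _∷_)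
open import Data.List.Relation.Unary.Any as Any using (Any; here; there; index)
open import Data.List.Relation.Unary.Any.Properties using (lookup-index)
open import Data.List.Relation.Unary.Sorted.TotalOrder.Properties using (Sorted⇒AllPairs)
open import Data.List.Relation.Unary.Unique.Propositional using (Unique)
import Data.List.Relation.Unary.Unique.Propositional.Properties as Unique
import Data.List.Sort as Sort
open import Data.Maybe using (Maybe; just; nothing; maybe)
open import Data.Nat using (ℕ; zero; suc; _+_; _*_; _^_; _⊓_; _≤_; _<_; _≥_; z<s; s<s; s<s⁻¹)
open import Data.Nat.Logarithm using (⌊log₂_⌋; ⌊log₂⌋-mono-≤; ⌊log₂[2^n]⌋≡n)
import Data.Nat.Properties as ℕ
open import Data.Nat.Solver using (module +-*-Solver)
open import Data.Product using (∃; _×_; _,_; proj₁; proj₂; swap)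
open import Data.Product.Properties using (≡-dec)
open import Data.Sum using (_⊎_; inj₁; inj₂; [_,_]′)
open import Function using (_∘_; id)
open import Relation.Binary using (tri<; tri≈; tri>)
import Relation.Binary.Construct.On as On
open import Relation.Binary.PropositionalEquality
  using (_≡_; _≢_; refl; sym; trans; cong; cong₂; subst; subst₂; setoid; module ≡-Reasoning)
open import Relation.Nullary using (¬_; Dec; yes; no; contradiction)
open import Relation.Nullary.Decidable using (_⊎-dec_)

private
  variable
    m n k : ℕ

-- Unordered pairs and their positions in an edge list.

≈-swap : (e : Pair n) → swap e ≈ e
≈-swap _ = inj₂ refl

≈-sym : {e f : Pair n} → e ≈ f → f ≈ e
≈-sym (inj₁ refl) = inj₁ refl
≈-sym (inj₂ refl) = inj₂ refl

≈-trans : {e f g : Pair n} → e ≈ f → f ≈ g → e ≈ g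
≈-trans (inj₁ refl) f≈g         = f≈g
≈-trans (inj₂ refl) (inj₁ refl) = inj₂ refl
≈-trans (inj₂ refl) (inj₂ refl) = inj₁ refl

image-≈ : (φ : Fin m → Fin n) {e f : Pair m} → e ≈ f → image φ e ≈ image φ f
image-≈ φ (inj₁ refl) = inj₁ refl
image-≈ φ (inj₂ refl) = inj₂ refl

_≈?_ : (e f : Pair n) → Dec (e ≈ f)
e ≈? f = ≡-dec Fin._≟_ Fin._≟_ e f ⊎-dec ≡-dec Fin._≟_ Fin._≟_ e (swap f)

Loopless-≈ : {e f : Pair n} → e ≈ f → Loopless f → Loopless e
Loopless-≈ (inj₁ refl) f-loopless = f-loopless
Loopless-≈ (inj₂ refl) f-loopless = f-loopless ∘ sym

-- Total, with the length of the list as value for an absent pair, so that `key` is defined on all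
-- pairs, as sorting by it requires.
position : List (Pair n) → Pair n → ℕ
position []       e = 0
position (f ∷ fs) e with e ≈? f
... | yes _ = 0
... | no  _ = suc (position fs e)

position-resp-≈ : (fs : List (Pair n)) {e e′ : Pair n} → e ≈ e′ → position fs e ≡ position fs e′
position-resp-≈ []       e≈e′ = refl
position-resp-≈ (f ∷ fs) {e} {e′} e≈e′ with e ≈? f | e′ ≈? f
... | yes _   | yes _    = refl
... | yes e≈f | no e′≉f  = contradiction (≈-trans (≈-sym e≈e′) e≈f) e′≉f
... | no e≉f  | yes e′≈f = contradiction (≈-trans e≈e′ e′≈f) e≉f
... | no _    | no _     = cong suc (position-resp-≈ fs e≈e′)

-- Distinctness makes the first match the only one. This turns the edge order of `G` into a
-- comparison of numbers.
position-lookup : {fs : List (Pair n)} → AllPairs _≉_ fs →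
                  ∀ i {e} → lookup fs i ≈ e → position fs e ≡ toℕ i
position-lookup {fs = f ∷ fs} (f≉fs ∷ _) i {e} fᵢ≈e with e ≈? f
position-lookup (_ ∷ _)    zero    fᵢ≈e | yes _   = refl
position-lookup (f≉fs ∷ _) (suc i) fᵢ≈e | yes e≈f =
  contradiction (≈-sym (≈-trans fᵢ≈e e≈f)) (All.lookup f≉fs (∈-lookup i))
position-lookup (_ ∷ _)    zero    fᵢ≈e | no e≉f = contradiction (≈-sym fᵢ≈e) e≉f
position-lookup (_ ∷ fs≉)  (suc i) fᵢ≈e | no _   = cong suc (position-lookup fs≉ i fᵢ≈e)

-- Increasing pairs, sorted lists and products of lists.

Increasing : Pair n → Set
Increasing (u , v) = u Fin.< v

increasing? : (e : Pair n) → Dec (Increasing e)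
increasing? (u , v) = u Fin.<? v

-- At most one orientation of an edge is increasing, so plain inequality already gives `_≉_`.
distinct-increasing : {es : List (Pair n)} → All Increasing es → Unique es → AllPairs _≉_ es
distinct-increasing []       []       = []
distinct-increasing (p ∷ ps) (d ∷ ds) =
  All.zipWith (λ { (q , e≢e′) (inj₁ e≡e′) → e≢e′ e≡e′
                 ; (q , e≢e′) (inj₂ refl) → Fin.<-asym p q }) (ps , d)
    ∷ distinct-increasing ps ds

-- Sortedness says nothing about the order of elements with equal keys, hence the strict inequality
-- between keys.
index-monotone : {A : Set} (key : A → ℕ) {xs : List A} → AllPairs (λ x y → key x ≤ key y) xs →
                 ∀ {x y} (x∈xs : x ∈ₗ xs) (y∈xs : y ∈ₗ xs) → key x < key y → index x∈xs Fin.< index y∈xs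
index-monotone key _        (here refl) (here refl) x<y = contradiction x<y (ℕ.<-irrefl refl)
index-monotone key _        (here _)    (there _)   x<y = z<s
index-monotone key (y≤ ∷ _) (there x∈)  (here refl) x<y = contradiction (All.lookup y≤ x∈) (ℕ.<⇒≱ x<y)
index-monotone key (_ ∷ s)  (there x∈)  (there y∈)  x<y = s<s (index-monotone key s x∈ y∈ x<y)

length-cartesianProduct : {A B : Set} (xs : List A) (ys : List B) →
                          length (cartesianProduct xs ys) ≡ length xs * length ys
length-cartesianProduct []       ys = refl
length-cartesianProduct (x ∷ xs) ys = begin
  length (map (x ,_) ys ++ cartesianProduct xs ys)
    ≡⟨ List.length-++ (map (x ,_) ys) ⟩
  length (map (x ,_) ys) + length (cartesianProduct xs ys)
    ≡⟨ cong₂ _+_ (List.length-map (x ,_) ys) (length-cartesianProduct xs ys) ⟩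
  length ys + length xs * length ys ∎
  where open ≡-Reasoning

-- Digits and the logarithm.

funToFin-cong : {f g : Fin m → Fin n} → (∀ i → f i ≡ g i) → funToFin f ≡ funToFin g
funToFin-cong {zero}  f≗g = refl
funToFin-cong {suc m} f≗g = cong₂ combine (f≗g zero) (funToFin-cong (f≗g ∘ suc))

-- `funToFin` rebuilds a number from its digits; the digit functions agree only pointwise, whence
-- `funToFin-cong`.
finToFun-injective : {i j : Fin (m ^ n)} → (∀ l → finToFun {m} {n} i l ≡ finToFun j l) → i ≡ j
finToFun-injective {m} {n} {i} {j} i≗j =
  trans (sym (Fin.funToFin-finToFin {n} {m} i))
    (trans (funToFin-cong i≗j) (Fin.funToFin-finToFin {n} {m} j))

-- Otherwise monotonicity of the logarithm would give `suc l ≤ l` for `l = ⌊log₂ n ⌋`. Hence `suc l`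
-- binary digits suffice to tell `n` vertices apart.
n<2^1+⌊log₂n⌋ : ∀ n → n < 2 ^ suc ⌊log₂ n ⌋
n<2^1+⌊log₂n⌋ n = ℕ.≰⇒> λ 2^1+l≤n → ℕ.<-irrefl refl
  (subst (_≤ ⌊log₂ n ⌋) (⌊log₂[2^n]⌋≡n (suc ⌊log₂ n ⌋)) (⌊log₂⌋-mono-≤ 2^1+l≤n))

-- Hubs, gadgets and the roles of vertices.

module Gadgets {m n k : ℕ} (u v : Fin m) (es : List (Pair m)) (n≤2^k : n ≤ 2 ^ k) where

  Hub : Fin n → Set
  Hub x = toℕ x < k * m

  hub? : ∀ x → Dec (Hub x)
  hub? x = toℕ x ℕ.<? k * m

  -- The gadget of a hub and the vertex of G that the hub plays there.
  place : Fin n → Maybe (Fin k × Fin m)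
  place x with hub? x
  ... | yes hub = just (remQuot m (fromℕ< hub))
  ... | no  _   = nothing

  digit : Fin k → Fin n → Fin 2
  digit i x = finToFun {2} {k} (inject≤ x n≤2^k) i

  differing-digit : ∀ {x y} → x ≢ y → ∃ λ i → digit i x ≢ digit i y
  differing-digit {x} {y} x≢y = Fin.¬∀⟶∃¬ k _ (λ i → digit i x Fin.≟ digit i y)
    λ same → x≢y (Fin.inject≤-injective n≤2^k n≤2^k x y (finToFun-injective {2} {k} same))

  endpoint : Fin 2 → Fin m
  endpoint zero    = u
  endpoint (suc _) = v

  -- This encodes the blow-up: a vertex outside the hubs takes part in every gadget, as `u` or `v`
  -- according to the digit. A hub keeps its own vertex of `G` whatever `i` is.
  role : Fin k → Fin n → Fin m
  role i x = maybe proj₂ (endpoint (digit i x)) (place x)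

  -- Only meaningful when x is a hub. Edges between different gadgets get
  -- junk keys, which is harmless: no copy uses them.
  key : Pair n → ℕ
  key (x , y) = maybe (λ (i , _) → position es (role i x , role i y)) 0 (place x)

  place-¬hub : ∀ {x} → ¬ Hub x → place x ≡ nothing
  place-¬hub {x} ¬hub with hub? x
  ... | yes hub = contradiction hub ¬hub
  ... | no  _   = refl

  hub-combine : (km≤n : k * m ≤ n) (i : Fin k) (a : Fin m) → Hub (inject≤ (combine i a) km≤n)
  hub-combine km≤n i a =
    subst (_< k * m) (sym (Fin.toℕ-inject≤ (combine i a) km≤n)) (Fin.toℕ<n (combine i a))

  place-combine : ∀ (km≤n : k * m ≤ n) i a → place (inject≤ (combine i a) km≤n) ≡ just (i , a)
  place-combine km≤n i a with hub? (inject≤ (combine i a) km≤n)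
  ... | yes hub = cong just (trans (cong (remQuot m) (Fin.toℕ-injective
                    (trans (Fin.toℕ-fromℕ< hub) (Fin.toℕ-inject≤ (combine i a) km≤n))))
                    (Fin.remQuot-combine i a))
  ... | no ¬hub = contradiction (hub-combine km≤n i a) ¬hub

  -- Truncated at n, so that the construction makes sense even when k * m > n;
  -- then every vertex is a hub and the graph is complete.
  hubs : List (Fin n)
  hubs = map (λ i → inject≤ i (ℕ.m⊓n≤n (k * m) n)) (allFin (k * m ⊓ n))

  hubPairs : List (Pair n)
  hubPairs = filter increasing? (cartesianProduct hubs (allFin n))

  length-hubPairs : length hubPairs ≤ k * m * n
  length-hubPairs = begin
    length hubPairs
      ≤⟨ List.length-filter increasing? (cartesianProduct hubs (allFin n)) ⟩
    length (cartesianProduct hubs (allFin n))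
      ≡⟨ length-cartesianProduct hubs (allFin n) ⟩
    length hubs * length (allFin n)
      ≡⟨ cong₂ _*_ (trans (List.length-map _ (allFin (k * m ⊓ n)))
                          (List.length-tabulate {n = k * m ⊓ n} _))
                   (List.length-tabulate {n = n} _) ⟩
    (k * m ⊓ n) * n
      ≤⟨ ℕ.*-monoˡ-≤ n (ℕ.m⊓n≤m (k * m) n) ⟩
    k * m * n ∎
    where open ℕ.≤-Reasoning

  ∈-hubs : ∀ {x} → Hub x → x ∈ₗ hubs
  ∈-hubs {x} hub = subst (_∈ₗ hubs)
    (Fin.toℕ-injective (trans (Fin.toℕ-inject≤ _ _) (Fin.toℕ-fromℕ< bound)))
    (∈-map⁺ _ (∈-allFin (fromℕ< bound)))
    where
    bound : toℕ x < k * m ⊓ n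
    bound = ℕ.⊓-pres-m< hub (Fin.toℕ<n x)

  ∈-hubPairs : ∀ {x y} → Hub x → x Fin.< y → (x , y) ∈ₗ hubPairs
  ∈-hubPairs {y = y} hub x<y =
    ∈-filter⁺ increasing? (∈-cartesianProduct⁺ (∈-hubs hub) (∈-allFin y)) x<y

  -- Hubs form an initial segment of `Fin n`, so the smaller endpoint of a pair meeting a hub is
  -- itself a hub. Thus increasing pairs that start at a hub cover all such edges, and `key` can
  -- read the gadget off the first endpoint.
  orient : ∀ e → Loopless e → Hub (proj₁ e) ⊎ Hub (proj₂ e) →
           ∃ λ f → f ∈ₗ hubPairs × Hub (proj₁ f) × f ≈ e
  orient (x , y) x≢y hub with Fin.<-cmp x y
  ... | tri≈ _ x≡y _ = contradiction x≡y x≢y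
  ... | tri< x<y _ _ = (x , y) , ∈-hubPairs hubₓ x<y , hubₓ , inj₁ refl
    where
    hubₓ : Hub x
    hubₓ = [ id , ℕ.<-trans x<y ]′ hub
  ... | tri> _ _ y<x = (y , x) , ∈-hubPairs hub′ y<x , hub′ , inj₂ refl
    where
    hub′ : Hub y
    hub′ = [ ℕ.<-trans y<x , id ]′ hub

  -- The hub graph, with its edges sorted by key.

  open Sort (On.decTotalOrder ℕ.≤-decTotalOrder key) using (sort; sort-↭; sort-↗)

  graphEdges : List (Pair n)
  graphEdges = sort hubPairs

  graphEdges-increasing : All Increasing graphEdges
  graphEdges-increasing = All-resp-↭ (↭-sym (sort-↭ hubPairs))
    (all-filter increasing? (cartesianProduct hubs (allFin n)))

  graphEdges-unique : Unique graphEdges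
  graphEdges-unique = Permutation.Unique-resp-↭ (setoid _) (↭⇒↭ₛ (↭-sym (sort-↭ hubPairs)))
    (Unique.filter⁺ increasing? (Unique.cartesianProduct⁺
      (Unique.map⁺ (Fin.inject≤-injective _ _ _ _) (Unique.allFin⁺ (k * m ⊓ n)))
      (Unique.allFin⁺ n)))

  graph : EdgeOrderedGraph n
  graph = mkGraph graphEdges
    (All.map (λ u<v u≡v → Fin.<-irrefl u≡v u<v) graphEdges-increasing)
    (distinct-increasing graphEdges-increasing graphEdges-unique)

  edgeCount-graph : edgeCount graph ≤ k * m * n
  edgeCount-graph = subst (_≤ k * m * n) (sym (↭-length (sort-↭ hubPairs))) length-hubPairs

  ∈-graphEdges : ∀ {e} → e ∈ₗ hubPairs → e ∈ₗ graphEdges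
  ∈-graphEdges = ∈-resp-↭ (↭-sym (sort-↭ hubPairs))

  ≈-∈-graph : ∀ {e f} → e ∈ₗ graphEdges → e ≈ f → f ∈ graph
  ≈-∈-graph e∈ e≈f = Any.map (λ { refl → ≈-sym e≈f }) e∈

  key-≺ : ∀ {e f} (e∈ : e ∈ₗ graphEdges) (f∈ : f ∈ₗ graphEdges) → key e < key f →
          index e∈ Fin.< index f∈
  key-≺ = index-monotone key (Sorted⇒AllPairs (On.totalOrder ℕ.≤-totalOrder key) (sort-↗ hubPairs))

  missing⇒¬hub : ∀ {x y} → Missing graph (x , y) → ¬ Hub x × ¬ Hub y
  missing⇒¬hub {x} {y} (x≢y , e∉) = avoid ∘ inj₁ , avoid ∘ inj₂
    where
    avoid : ¬ (Hub x ⊎ Hub y)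
    avoid hub with f , f∈ , _ , f≈e ← orient (x , y) x≢y hub = e∉ (≈-∈-graph (∈-graphEdges f∈) f≈e)

  -- One vertex outside the hubs shows that `hubs` was not truncated, so every vertex of every
  -- gadget has its own hub.
  ¬hub⇒km≤n : ∀ {x} → ¬ Hub x → k * m ≤ n
  ¬hub⇒km≤n {x} ¬hub = ℕ.≤-trans (ℕ.≮⇒≥ ¬hub) (ℕ.<⇒≤ (Fin.toℕ<n x))

  -- The copy of `G` completed by an edge between two vertices outside the hubs.

  module Embedding (u≢v : u ≢ v) (es-loopless : All Loopless es) (uv≉es : All ((u , v) ≉_) es)
    (es-distinct : AllPairs _≉_ es) (km≤n : k * m ≤ n) (i : Fin k) {x y : Fin n}
    (¬hubₓ : ¬ Hub x) (¬hubᵧ : ¬ Hub y)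
    (x-end : endpoint (digit i x) ≡ u) (y-end : endpoint (digit i y) ≡ v)
    where

    embed : Fin m → Fin n
    embed a with a Fin.≟ u | a Fin.≟ v
    ... | yes _ | _     = x
    ... | no  _ | yes _ = y
    ... | no  _ | no  _ = inject≤ (combine i a) km≤n

    -- This left inverse yields both the injectivity of `embed` and the keys of the embedded edges.
    role-embed : ∀ a → role i (embed a) ≡ a
    role-embed a with a Fin.≟ u | a Fin.≟ v
    ... | yes a≡u | _       rewrite place-¬hub ¬hubₓ = trans x-end (sym a≡u)
    ... | no  _   | yes a≡v rewrite place-¬hub ¬hubᵧ = trans y-end (sym a≡v)
    ... | no  _   | no  _   rewrite place-combine km≤n i a = refl

    place-embed : ∀ a → Hub (embed a) → place (embed a) ≡ just (i , a)
    place-embed a hub with a Fin.≟ u | a Fin.≟ v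
    ... | yes _ | _     = contradiction hub ¬hubₓ
    ... | no  _ | yes _ = contradiction hub ¬hubᵧ
    ... | no  _ | no  _ = place-combine km≤n i a

    endpoint-or-hub : ∀ a → a ≡ u ⊎ a ≡ v ⊎ Hub (embed a)
    endpoint-or-hub a with a Fin.≟ u | a Fin.≟ v
    ... | yes a≡u | _       = inj₁ a≡u
    ... | no  _   | yes a≡v = inj₂ (inj₁ a≡v)
    ... | no  _   | no  _   = inj₂ (inj₂ (hub-combine km≤n i a))

    embed-u : embed u ≡ x
    embed-u with u Fin.≟ u | u Fin.≟ v
    ... | yes _  | _ = refl
    ... | no u≢u | _ = contradiction refl u≢u

    embed-v : embed v ≡ y
    embed-v with v Fin.≟ u | v Fin.≟ v
    ... | yes v≡u | _      = contradiction (sym v≡u) u≢v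
    ... | no _    | yes _  = refl
    ... | no _    | no v≢v = contradiction refl v≢v

    embed-injective : ∀ {a b} → embed a ≡ embed b → a ≡ b
    embed-injective {a} {b} eq = trans (sym (role-embed a)) (trans (cong (role i) eq) (role-embed b))

    -- Only `u` and `v` are sent outside the hubs, so the one edge that can miss them is `uv`, which
    -- the new edge supplies.
    edge-meets-hub : ∀ a b → a ≢ b → (a , b) ≉ (u , v) → Hub (embed a) ⊎ Hub (embed b)
    edge-meets-hub a b a≢b ab≉uv with endpoint-or-hub a | endpoint-or-hub b
    ... | inj₂ (inj₂ hub)  | _                = inj₁ hub
    ... | inj₁ _           | inj₂ (inj₂ hub)  = inj₂ hub
    ... | inj₂ (inj₁ _)    | inj₂ (inj₂ hub)  = inj₂ hub
    ... | inj₁ refl        | inj₁ refl        = contradiction refl a≢b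
    ... | inj₁ refl        | inj₂ (inj₁ refl) = contradiction (inj₁ refl) ab≉uv
    ... | inj₂ (inj₁ refl) | inj₁ refl        = contradiction (inj₂ refl) ab≉uv
    ... | inj₂ (inj₁ refl) | inj₂ (inj₁ refl) = contradiction refl a≢b

    key-embed : ∀ a b → Hub (embed a) → key (image embed (a , b)) ≡ position es (a , b)
    key-embed a b hub = trans
      (cong (maybe (λ (j , _) → position es (role j (embed a) , role j (embed b))) 0)
            (place-embed a hub))
      (cong (position es) (cong₂ _,_ (role-embed a) (role-embed b)))

    embed-edge : ∀ e → Any (e ≈_) es →
                 ∃ λ f → f ∈ₗ graphEdges × f ≈ image embed e × key f ≡ position es e
    embed-edge e@(a , b) e∈es
      with e-loopless ← All.lookupWith (λ l e≈f → Loopless-≈ e≈f l) es-loopless e∈es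
         | e≉uv ← All.lookupWith (λ uv≉f e≈f e≈uv → uv≉f (≈-trans (≈-sym e≈uv) e≈f)) uv≉es e∈es
      with orient (image embed e) (e-loopless ∘ embed-injective) (edge-meets-hub a b e-loopless e≉uv)
    ... | f , f∈ , hub , f≈@(inj₁ refl) = f , ∈-graphEdges f∈ , f≈ , key-embed a b hub
    -- The listed edge is the reversed image, so its key is read from `b`; `position` ignores the
    -- orientation.
    ... | f , f∈ , hub , f≈@(inj₂ refl) = f , ∈-graphEdges f∈ , f≈ ,
      trans (key-embed b a hub) (position-resp-≈ es (≈-swap (a , b)))

    copy : ∀ {l d e} (missing : Missing graph e) → (x , y) ≈ e →
           CopyUsing (mkGraph ((u , v) ∷ es) l d) (addSmallest graph e missing) e
    copy {l} {d} {e} missing xy≈e =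
      embed , mkCopy embed-injective preserves-edges preserves-order , (u , v) , here (inj₁ refl) , uv≈e
      where
      G : EdgeOrderedGraph m
      G = mkGraph ((u , v) ∷ es) l d

      H : EdgeOrderedGraph n
      H = addSmallest graph e missing

      uv≈e : image embed (u , v) ≈ e
      uv≈e = subst (_≈ e) (sym (cong₂ _,_ embed-u embed-v)) xy≈e

      preserves-edges : ∀ f → f ∈ G → image embed f ∈ H
      preserves-edges f (here f≈uv) = here (≈-trans (image-≈ embed f≈uv) uv≈e)
      preserves-edges f (there f∈es) with g , g∈ , g≈f , _ ← embed-edge f f∈es = there (≈-∈-graph g∈ g≈f)

      lookup-≈ : ∀ {g f} (g∈ : g ∈ₗ graphEdges) → g ≈ f → lookup graphEdges (index g∈) ≈ f
      lookup-≈ g∈ g≈f = subst (_≈ _) (lookup-index g∈) g≈f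

      ∈-es : ∀ j {f} → lookup es j ≈ f → Any (f ≈_) es
      ∈-es j eⱼ≈f = Any.map (λ { refl → ≈-sym eⱼ≈f }) (∈-lookup j)

      preserves-order : ∀ f f′ → G ⊢ f ≺ f′ → H ⊢ image embed f ≺ image embed f′
      -- `uv` heads the edge list of `G` and the new edge heads that of `H`, so any index in the
      -- tail will do.
      preserves-order f f′ (zero , suc j , _ , uv≈f , eⱼ≈f′)
        with g , g∈ , g≈f′ , _ ← embed-edge f′ (∈-es j eⱼ≈f′) =
        zero , suc (index g∈) , z<s ,
        ≈-trans (≈-sym uv≈e) (image-≈ embed uv≈f) , lookup-≈ g∈ g≈f′
      -- Both images are old edges whose keys are the positions in `es`; these differ strictly, so
      -- sorting respects them.
      preserves-order f f′ (suc j , suc j′ , j<j′ , eⱼ≈f , eⱼ≈f′)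
        with g , g∈ , g≈f , key-g ← embed-edge f (∈-es j eⱼ≈f)
           | g′ , g′∈ , g′≈f′ , key-g′ ← embed-edge f′ (∈-es j′ eⱼ≈f′) =
        suc (index g∈) , suc (index g′∈) , s<s (key-≺ g∈ g′∈ key<) , lookup-≈ g∈ g≈f , lookup-≈ g′∈ g′≈f′
        where
        key< : key g < key g′
        key< = subst₂ _<_ (sym (trans key-g (position-lookup es-distinct j eⱼ≈f)))
                          (sym (trans key-g′ (position-lookup es-distinct j′ eⱼ≈f′))) (s<s⁻¹ j<j′)

  -- Semisaturation and the bound.

  opposite-endpoints : ∀ b c → b ≢ c →
                       (endpoint b ≡ u × endpoint c ≡ v) ⊎ (endpoint b ≡ v × endpoint c ≡ u)
  opposite-endpoints zero       zero       b≢c = contradiction refl b≢c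
  opposite-endpoints zero       (suc _)    b≢c = inj₁ (refl , refl)
  opposite-endpoints (suc _)    zero       b≢c = inj₂ (refl , refl)
  opposite-endpoints (suc zero) (suc zero) b≢c = contradiction refl b≢c

  graph-semisaturated : ∀ {l d} → Semisaturated (mkGraph ((u , v) ∷ es) l d) graph
  graph-semisaturated {u≢v ∷ l} {uv≉ ∷ d} (x , y) missing@(x≢y , _)
    with ¬hubₓ , ¬hubᵧ ← missing⇒¬hub missing | i , differ ← differing-digit x≢y
    with opposite-endpoints (digit i x) (digit i y) differ
  ... | inj₁ (x-end , y-end) = E.copy missing (inj₁ refl)
    where module E = Embedding u≢v l uv≉ d (¬hub⇒km≤n ¬hubₓ) i ¬hubₓ ¬hubᵧ x-end y-end
  -- Here `y` plays `u` and `x` plays `v`; the new edge is the same unordered pair.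
  ... | inj₂ (x-end , y-end) = E.copy missing (inj₂ refl)
    where module E = Embedding u≢v l uv≉ d (¬hub⇒km≤n ¬hubₓ) i ¬hubᵧ ¬hubₓ y-end x-end

ssatₘ-bound : (G : EdgeOrderedGraph m) → edgeCount G ≥ 1 → n ≤ 2 ^ k → ssatₘ n G ≤ k * m * n
ssatₘ-bound {m} {n} {k} G@(mkGraph ((u , v) ∷ es) (_ ∷ _) (_ ∷ _)) _ n≤2^k =
  ℕ.≤-trans (proj₂ (ssatₘ-isMinimum n G) _ (graph , refl , graph-semisaturated)) edgeCount-graph
  where open Gadgets {m} {n} {k} u v es n≤2^k

theorem7 : ∀ {m : ℕ} (G : EdgeOrderedGraph m) → edgeCount G ≥ 1 →
    (λ n → ssatₘ n G) =O (λ n → n * ⌊log₂ n ⌋)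
theorem7 {m} G nonempty = 2 * m , 2 , λ n n≥2 →
  let l = ⌊log₂ n ⌋ in begin
  ssatₘ n G          ≤⟨ ssatₘ-bound {k = suc l} G nonempty (ℕ.<⇒≤ (n<2^1+⌊log₂n⌋ n)) ⟩
  -- From `n ≥ 2` follows `1 ≤ l`, so `suc l ≤ l + l`: this fixes the threshold 2 and the factor 2
  -- in the constant.
  suc l * m * n      ≤⟨ ℕ.*-monoˡ-≤ n (ℕ.*-monoˡ-≤ m (ℕ.+-monoˡ-≤ l (⌊log₂⌋-mono-≤ n≥2))) ⟩
  (l + l) * m * n    ≡⟨ solve 3 (λ l m n → (l :+ l) :* m :* n := con 2 :* m :* (n :* l)) refl l m n ⟩
  2 * m * (n * l)    ∎
  where
  open ℕ.≤-Reasoning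
  open +-*-Solver
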